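{- Let $k,t,\omega$ be integers with $k=\omega$, $k\geq 4$ and $t\geq\omega+1$. Then $$\operatorname{gr}_k(P_5:PA_{t,\omega})=(\omega-1)(t-1)+1 .$$
   Context: All graphs are finite, simple and undirected. $K_n$ is the complete graph on $n$ vertices and $P_5$ is the path with $5$ vertices and $4$ edges. For $t\geq\omega+1$, the pineapple $PA_{t,\omega}$ is the graph of order $t$ obtained from the complete graph $K_\omega$ by attaching $t-\omega$ pendent vertices to one and the same vertex of $K_\omega$. A $k$-edge-coloring assigns to each edge one of $k$ colors; all $k$-edge-colorings are assumed exact, i.e. each of the $k$ colors is used at least once. An edge-colored graph is rainbow if all its edges have different colors and monochromatic if all its edges have a single color. A copy of a graph means a (not necessarily induced) subgraph isomorphic to it. For non-empty graphs $G,H$ (graphs with at least one edge) and a positive integer $k$, the Gallai-Ramsey number $\operatorname{gr}_k(G:H)$ is the minimum integer $N$ with $\binom{N}{2}\geq k$ (so that $K_N$ admits a $k$-edge-coloring) such that for all $n\geq N$, every $k$-edge-coloring of $K_n$ contains either a rainbow copy of $G$ or a monochromatic copy of $H$. -}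

module Defs where

open import Data.Nat using (ℕ; suc; _≤_; _<_; _≥_; _≤?_; _<?_)
import Data.Nat as ℕ
open import Data.Nat.Properties using (1+n≢n)
open import Data.Nat.Combinatorics using (_C_)
open import Data.Fin using (Fin; toℕ; _≟_)
open import Data.Product using (∃; ∃-syntax; _×_; _,_; swap)
import Data.Product as Product
open import Data.Sum using (_⊎_; [_,_])
import Data.Sum as Sum
open import Function.Definitions using (Injective)
open import Relation.Binary.Definitions using (Symmetric; Decidable)
open import Relation.Binary.PropositionalEquality using (_≡_; _≢_; refl; ≢-sym)
open import Relation.Nullary using (¬_)
open import Relation.Nullary.Decidable using (¬?; _×-dec_; _⊎-dec_)

record Graph : Set₁ where
  field
    order  : ℕ
    Adj    : Fin order → Fin order → Set
    adj?   : Decidable Adj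
    adjSym : Symmetric Adj
    irrefl : ∀ {v} → ¬ Adj v v

  Vertex : Set
  Vertex = Fin order

open Graph public using (order; Vertex)

K : ℕ → Graph
K n = record
  { order  = n
  ; Adj    = _≢_
  ; adj?   = λ u v → ¬? (u ≟ v)
  ; adjSym = ≢-sym
  ; irrefl = λ v≢v → v≢v refl
  }

-- The path on n vertices 0 – 1 – ⋯ – (n - 1).
P : ℕ → Graph
P n = record
  { order  = n
  ; Adj    = λ u v → suc (toℕ u) ≡ toℕ v ⊎ suc (toℕ v) ≡ toℕ u
  ; adj?   = λ u v → (suc (toℕ u) ℕ.≟ toℕ v) ⊎-dec (suc (toℕ v) ℕ.≟ toℕ u)
  ; adjSym = Sum.swap
  ; irrefl = [ 1+n≢n , 1+n≢n ]
  }

-- The vertices 0, …, ω - 1 form the clique K_ω, and the remaining vertices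
-- ω, …, t - 1 are pendent at vertex 0.  Only meaningful for 1 ≤ ω ≤ t.
PA : (t ω : ℕ) → Graph
PA t ω = record
  { order  = t
  ; Adj    = λ u v → u ≢ v × (Clique u v ⊎ Pendent u v ⊎ Pendent v u)
  ; adj?   = λ u v → ¬? (u ≟ v) ×-dec
               (((toℕ u <? ω) ×-dec (toℕ v <? ω)) ⊎-dec
                (pendent? u v ⊎-dec pendent? v u))
  ; adjSym = Product.map ≢-sym (Sum.map swap Sum.swap)
  ; irrefl = λ (v≢v , _) → v≢v refl
  }
  where
  Clique Pendent : Fin t → Fin t → Set
  Clique  u v = toℕ u < ω × toℕ v < ω
  Pendent u v = toℕ u ≡ 0 × ω ≤ toℕ v

  pendent? : Decidable Pendent
  pendent? u v = (toℕ u ℕ.≟ 0) ×-dec (ω ≤? toℕ v)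

-- An injective homomorphism, whose image is a not necessarily induced
-- subgraph of H isomorphic to G.
record Copy (G H : Graph) : Set where
  private
    module G = Graph G
    module H = Graph H
  field
    embed     : Vertex G → Vertex H
    injective : Injective _≡_ _≡_ embed
    preserves : ∀ {u v} → G.Adj u v → H.Adj (embed u) (embed v)

-- `colour` is total on pairs of vertices for convenience; its values on
-- non-adjacent pairs (in particular on the diagonal) are never inspected.
-- Accordingly `exact` asks for every colour to occur on an actual edge.
record EdgeColouring (G : Graph) (k : ℕ) : Set where
  open Graph G using (Adj)
  field
    colour    : Vertex G → Vertex G → Fin k
    colourSym : ∀ u v → colour u v ≡ colour v u
    exact     : ∀ c → ∃[ u ] ∃[ v ] (Adj u v × colour u v ≡ c)

module _ {G H : Graph} {k : ℕ} (χ : EdgeColouring H k) (φ : Copy G H) where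
  open Graph G using (Adj)
  open EdgeColouring χ using (colour)
  open Copy φ using (embed)

  -- Each edge is presented by both of its orientations, so edges of the same
  -- colour are only required to agree up to swapping their endpoints.
  Rainbow : Set
  Rainbow = ∀ {u v x y} → Adj u v → Adj x y →
            colour (embed u) (embed v) ≡ colour (embed x) (embed y) →
            (u ≡ x × v ≡ y) ⊎ (u ≡ y × v ≡ x)

  Monochromatic : Set
  Monochromatic = ∃[ c ] (∀ {u v} → Adj u v → colour (embed u) (embed v) ≡ c)

GallaiRamseyBound : (k : ℕ) (G H : Graph) → ℕ → Set
GallaiRamseyBound k G H N =
  N C 2 ≥ k ×
  (∀ n → n ≥ N → (χ : EdgeColouring (K n) k) →
     (∃ λ (φ : Copy G (K n)) → Rainbow χ φ) ⊎
     (∃ λ (φ : Copy H (K n)) → Monochromatic χ φ))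

-- gr[ k ]⟨ G ∶ H ⟩≡ N says that gr_k(G : H) exists and equals N.  It is a
-- relation because a function would need a proof that a bound exists for all
-- k, G and H.
gr[_]⟨_∶_⟩≡_ : (k : ℕ) (G H : Graph) → ℕ → Set
gr[ k ]⟨ G ∶ H ⟩≡ N =
  GallaiRamseyBound k G H N × (∀ M → GallaiRamseyBound k G H M → N ≤ M)

{-# OPTIONS --safe #-}

-- Lower bound: split (ω - 1)(t - 1) vertices into ω - 1 blocks of t - 1 vertices, give each block
-- its own colour and all edges between blocks the remaining colour.
--
-- Upper bound: suppose some vertex v sees three colours, on va, vb and vc, and let xy be an edge of
-- a fourth colour.  If there is no rainbow P₅, any two adjacent edges pq and qr avoiding
-- v, a, b, c, x, y have the same colour, which is a statement about at most nine vertices and is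
-- settled by a search; so all but six vertices form a monochromatic clique.  If every vertex sees
-- at most two colours, some colour d is seen by all vertices, and the other colours induce
-- disjoint vertex classes between which all edges have colour d.  A vertex in no class is the hub
-- of a pineapple of colour d.  Otherwise a class has at least t vertices; either it is a
-- monochromatic clique, or it contains an edge of colour d, which extends by representatives of
-- the other classes to a clique of colour d, and any of these representatives serves as hub.
module Submission where

open import Data.Bool using (if_then_else_; _∨_)
open import Data.Empty using (⊥)
open import Data.Fin using (Fin; zero; suc; toℕ; #_; _↑ʳ_)
import Data.Fin as Fin
import Data.Fin.Properties as Finₚ
open import Data.List using (List; []; _∷_; _++_; map; length; lookup; concatMap; deduplicate; allFin; filter; take)
import Data.List.Membership.DecPropositional as DecMembership
open import Data.List.Membership.Propositional using (_∈_; _∉_; lose; find)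
open import Data.List.Membership.Propositional.Properties using (∈-map⁺; ∈-deduplicate⁺; ∈-lookup; ∈-filter⁺; ∈-filter⁻; ∈-allFin)
import Data.List.Properties as Listₚ
open import Data.List.Relation.Binary.Pointwise using (Pointwise; []; _∷_)
open import Data.List.Relation.Unary.All as All using (All; []; _∷_)
import Data.List.Relation.Unary.All.Properties as Allₚ
open import Data.List.Relation.Unary.AllPairs as AllPairs using (AllPairs; []; _∷_)
import Data.List.Relation.Unary.AllPairs.Properties as AllPairsₚ
open import Data.List.Relation.Unary.Any as Any using (Any; here; there)
import Data.List.Relation.Unary.Any.Properties as Anyₚ
import Data.List.Relation.Unary.Unique.DecPropositional as DecUnique
open import Data.List.Relation.Unary.Unique.Propositional using (Unique)
import Data.List.Relation.Unary.Unique.Propositional.Properties as Uniqueₚ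
open import Data.Maybe as Maybe using (Maybe; just; nothing; from-just; maybe′; _>>=_; _<∣>_)
open import Data.Nat using (ℕ; zero; suc; _+_; _*_; _∸_; _≤_; _<_; _≥_; z≤n; s≤s)
import Data.Nat as ℕ
open import Data.Nat.Combinatorics using (_C_; nCk+nC[k+1]≡[n+1]C[k+1]; nC1≡n)
import Data.Nat.Properties as ℕₚ
open import Data.Product using (∃; ∃₂; _×_; _,_; proj₁; proj₂; swap; uncurry)
open import Data.Product.Properties using (≡-dec)
open import Data.Sum using (_⊎_; inj₁; inj₂)
open import Function using (_∘_; _⇔_; mk⇔; Equivalence)
open import Function.Definitions using (Injective)
open import Relation.Binary.Definitions using (Symmetric; DecidableEquality)
open import Relation.Binary.PropositionalEquality using (_≡_; _≢_; refl; sym; trans; cong; cong₂; subst; subst₂; ≢-sym)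
open import Relation.Nullary using (¬_; Dec; yes; no; contradiction; does)
open import Relation.Nullary.Decidable using (¬?; _×-dec_; dec⇒maybe; decidable-stable)
open import Defs

-- Rainbow paths as lists of vertices.

AllPairs-lookup : ∀ {A : Set} {R : A → A → Set} → Symmetric R → ∀ {xs} → AllPairs R xs →
                  ∀ {i j} → i ≢ j → R (lookup xs i) (lookup xs j)
AllPairs-lookup R-sym (_ ∷ _)   {zero}  {zero}  i≢j = contradiction refl i≢j
AllPairs-lookup R-sym (rs ∷ _)  {zero}  {suc j} _   = All.lookup rs (∈-lookup j)
AllPairs-lookup R-sym (rs ∷ _)  {suc i} {zero}  _   = R-sym (All.lookup rs (∈-lookup i))
AllPairs-lookup R-sym (_ ∷ rss) {suc i} {suc j} i≢j = AllPairs-lookup R-sym rss (i≢j ∘ cong suc)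

lookup-injective : ∀ {A : Set} {xs : List A} → Unique xs → Injective _≡_ _≡_ (lookup xs)
lookup-injective xs! {i} {j} eq with i Fin.≟ j
... | yes i≡j = i≡j
... | no  i≢j = contradiction eq (AllPairs-lookup ≢-sym xs! i≢j)

steps : {A : Set} → List A → List (A × A)
steps []           = []
steps (_ ∷ [])     = []
steps (x ∷ y ∷ zs) = (x , y) ∷ steps (y ∷ zs)

steps-map : ∀ {A B : Set} (f : A → B) vs →
            steps (map f vs) ≡ map (λ (x , y) → f x , f y) (steps vs)
steps-map f []           = refl
steps-map f (_ ∷ [])     = refl
steps-map f (_ ∷ y ∷ zs) = cong (_ ∷_) (steps-map f (y ∷ zs))

-- Vertices and colours are left abstract, so that the same notion applies to the names used by the
-- search and to the vertices of a complete graph.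
RainbowTrail : {A C : Set} → (A × A → C) → List A → Set
RainbowTrail c vs = Unique vs × Unique (map c (steps vs))

-- Indexes each edge of the path by its first endpoint, so that distinctness of the colour list
-- identifies edges of equal colour.
lookup-steps : ∀ {A C : Set} (c : A × A → C) vs (u v : Fin (length vs)) → suc (toℕ u) ≡ toℕ v →
               ∃ λ i → toℕ i ≡ toℕ u × lookup (map c (steps vs)) i ≡ c (lookup vs u , lookup vs v)
lookup-steps c (x ∷ y ∷ zs) zero    (suc zero) _  = zero , refl , refl
lookup-steps c (x ∷ y ∷ zs) (suc u) (suc v)    eq =
  let i , i≡u , eq′ = lookup-steps c (y ∷ zs) u v (ℕₚ.suc-injective eq) in
  suc i , cong suc i≡u , eq′

-- Equal colours give equal positions in the colour list, hence equal first endpoints; the four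
-- orientation cases reduce to `forward` by symmetry of the colouring.
trail⇒copy : ∀ {n k} (χ : EdgeColouring (K n) k) vs →
             RainbowTrail (uncurry (EdgeColouring.colour χ)) vs →
             ∃ λ (φ : Copy (P (length vs)) (K n)) → Rainbow χ φ
trail⇒copy {n} χ vs (vs! , cs!) = φ , rainbow
  where
  open EdgeColouring χ
  open Graph (P (length vs)) using (Adj; irrefl)

  φ : Copy (P (length vs)) (K n)
  φ = record
    { embed     = lookup vs
    ; injective = lookup-injective vs!
    ; preserves = λ {u} uv eq →
        irrefl {u} (subst (Adj u) (sym (lookup-injective vs! eq)) uv)
    }

  forward : ∀ {u v x y} → suc (toℕ u) ≡ toℕ v → suc (toℕ x) ≡ toℕ y →
            colour (lookup vs u) (lookup vs v) ≡ colour (lookup vs x) (lookup vs y) →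
            u ≡ x × v ≡ y
  forward {u} {v} {x} {y} uv xy eq with lookup-steps (uncurry colour) vs u v uv
                                      | lookup-steps (uncurry colour) vs x y xy
  ... | i , i≡u , ci | j , j≡x , cj
    with refl ← lookup-injective cs! {i} {j} (trans ci (trans eq (sym cj)))
    with refl ← Finₚ.toℕ-injective {i = u} {x} (trans (sym i≡u) j≡x)
    = refl , Finₚ.toℕ-injective (trans (sym uv) xy)

  rainbow : Rainbow χ φ
  rainbow (inj₁ uv) (inj₁ xy) eq = inj₁ (forward uv xy eq)
  rainbow (inj₁ uv) (inj₂ yx) eq = inj₂ (forward uv yx (trans eq (colourSym _ _)))
  rainbow (inj₂ vu) (inj₁ xy) eq = inj₂ (swap (forward vu xy (trans (colourSym _ _) eq)))
  rainbow (inj₂ vu) (inj₂ yx) eq =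
    inj₁ (swap (forward vu yx (trans (colourSym _ _) (trans eq (colourSym _ _)))))

-- A certifying search over edge colourings.

firstJust : ∀ {A : Set} {B : A → Set} → (∀ x → Maybe (B x)) → List A → Maybe (∃ B)
firstJust f []       = nothing
firstJust f (x ∷ xs) = Maybe.map (x ,_) (f x) <∣> firstJust f xs

allJust : ∀ {A : Set} {B : A → Set} → (∀ x → Maybe (B x)) → ∀ xs → Maybe (All B xs)
allJust f []       = just []
allJust f (x ∷ xs) = Maybe.zipWith _∷_ (f x) (allJust f xs)

module Search {m k : ℕ} where

  Edge : Set
  Edge = Fin m × Fin m

  -- The labels stand for colours that are known only up to equality.
  State : Set
  State = List (Edge × ℕ)

  Labelled : State → Edge → ℕ → Set
  Labelled σ e i = (e , i) ∈ σ ⊎ (swap e , i) ∈ σ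

  record Models (σ : State) (c : Edge → Fin k) : Set where
    field
      c-sym    : ∀ e → c (swap e) ≡ c e
      faithful : ∀ {e e′ i j} → (e , i) ∈ σ → (e′ , j) ∈ σ → i ≡ j ⇔ c e ≡ c e′

    faithful-labels : ∀ {e e′ i j} → Labelled σ e i → Labelled σ e′ j → i ≡ j ⇔ c e ≡ c e′
    faithful-labels {e} {e′} (inj₁ p) (inj₁ q) = faithful p q
    faithful-labels {e} {e′} (inj₁ p) (inj₂ q) rewrite sym (c-sym e′) = faithful p q
    faithful-labels {e} {e′} (inj₂ p) (inj₁ q) rewrite sym (c-sym e) = faithful p q
    faithful-labels {e} {e′} (inj₂ p) (inj₂ q) rewrite sym (c-sym e) | sym (c-sym e′) = faithful p q

  open Equivalence

  extend : ∀ {σ c e i} → Models σ c →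
           (∀ {e′ j} → (e′ , j) ∈ σ → i ≡ j ⇔ c e ≡ c e′) → Models ((e , i) ∷ σ) c
  extend {σ} {c} {e} {i} M new = record { c-sym = Models.c-sym M ; faithful = faith }
    where
    faith : ∀ {e₁ e₂ i₁ i₂} → (e₁ , i₁) ∈ ((e , i) ∷ σ) → (e₂ , i₂) ∈ ((e , i) ∷ σ) →
            i₁ ≡ i₂ ⇔ c e₁ ≡ c e₂
    faith (here refl) (here refl) = mk⇔ (λ _ → refl) (λ _ → refl)
    faith (here refl) (there q)   = new q
    faith (there p)   (here refl) = mk⇔ (sym ∘ to (new p) ∘ sym) (sym ∘ from (new p) ∘ sym)
    faith (there p)   (there q)   = Models.faithful M p q

  infix 4 _≟ᵉ_
  _≟ᵉ_ : DecidableEquality Edge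
  _≟ᵉ_ = ≡-dec Fin._≟_ Fin._≟_

  label : ∀ σ e → Maybe (∃ (Labelled σ e))
  label []             e = nothing
  label ((e′ , i) ∷ σ) e with e ≟ᵉ e′ | swap e ≟ᵉ e′
  ... | yes refl | _        = just (i , inj₁ (here refl))
  ... | no _     | yes refl = just (i , inj₂ (here refl))
  ... | no _     | no _     with label σ e
  ...   | nothing           = nothing
  ...   | just (j , inj₁ p) = just (j , inj₁ (there p))
  ...   | just (j , inj₂ p) = just (j , inj₂ (there p))

  labels : ∀ σ es → Maybe (∃ (Pointwise (Labelled σ) es))
  labels σ []       = just ([] , [])
  labels σ (e ∷ es) =
    Maybe.zipWith (λ (i , p) (is , ps) → i ∷ is , p ∷ ps) (label σ e) (labels σ es)

  Unique-labels : ∀ {σ c es is} → Models σ c → Pointwise (Labelled σ) es is →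
                  Unique is → Unique (map c es)
  Unique-labels M []       []          = []
  Unique-labels {σ} {c} M (p ∷ ps) (i∉ ∷ is!) = differ ps i∉ ∷ Unique-labels M ps is!
    where
    differ : ∀ {es is} → Pointwise (Labelled σ) es is → All (_ ≢_) is → All (c _ ≢_) (map c es)
    differ []       []           = []
    differ (q ∷ qs) (i≢j ∷ i∉) = (i≢j ∘ from (Models.faithful-labels M p q)) ∷ differ qs i∉

  -- Only labels are compared, so one successful check serves every colouring that models `σ`.
  rainbowTrail : ∀ σ vs → Maybe (∀ {c} → Models σ c → RainbowTrail c vs)
  rainbowTrail σ vs = do
    vs!      ← dec⇒maybe (DecUnique.unique? Fin._≟_ vs)
    is , ps  ← labels σ (steps vs)
    is!      ← dec⇒maybe (DecUnique.unique? ℕ._≟_ is)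
    just (λ M → vs! , Unique-labels M ps is!)

  neighbours : State → Fin m → List (Fin m × ℕ)
  neighbours []                  v = []
  neighbours (((u , w) , i) ∷ σ) v =
    if does (u Fin.≟ v) then (w , i) ∷ neighbours σ v else
    if does (w Fin.≟ v) then (u , i) ∷ neighbours σ v else neighbours σ v

  -- The candidates need no correctness proof since `rainbowTrail` checks them.
  candidates : State → ℕ → Fin m → List (Fin m) → List ℕ → List (List (Fin m))
  candidates σ zero    v vs is = (v ∷ vs) ∷ []
  candidates σ (suc l) v vs is = concatMap
    (λ (w , i) → if does (w DecFin.∈? v ∷ vs) ∨ does (i Decℕ.∈? is) then []
                 else candidates σ l w (v ∷ vs) (i ∷ is))
    (neighbours σ v)
    where
    module DecFin = DecMembership Fin._≟_
    module Decℕ   = DecMembership ℕ._≟_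

  -- The equalities in `eqs` are those refuted wherever a search result is applied, so a branch may
  -- be closed by any of them as well as by a rainbow path with `l` edges.
  Conclusion : ℕ → List (Edge × Edge) → (Edge → Fin k) → Set
  Conclusion l eqs c =
    (∃ λ vs → length vs ≡ suc l × RainbowTrail c vs) ⊎ Any (λ (e , e′) → c e ≡ c e′) eqs

  module _ (l : ℕ) (eqs : List (Edge × Edge)) where

    Forces : State → Set
    Forces σ = ∀ {c} → Models σ c → Conclusion l eqs c

    findTrail : ∀ σ → Maybe (Forces σ)
    findTrail σ = do
      vs , len , trail ← firstJust
        (λ vs → Maybe.zip (dec⇒maybe (length vs ℕ.≟ suc l)) (rainbowTrail σ vs))
        (concatMap (λ v → candidates σ l v [] []) (allFin m))
      just (λ M → inj₁ (vs , len , trail M))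

    findEquality : ∀ σ → Maybe (Forces σ)
    findEquality σ = go eqs (λ _ → inj₂)
      where
      -- `inject` carries an equality found in the tail `es` back into the full list `eqs`.
      go : ∀ es → (∀ c → Any (λ (e , e′) → c e ≡ c e′) es → Conclusion l eqs c) →
           Maybe (Forces σ)
      go []              _      = nothing
      go ((e , e′) ∷ es) inject =
        (do i , p ← label σ e
            j , q ← label σ e′
            i≡j   ← dec⇒maybe (i ℕ.≟ j)
            just (λ {c} M → inject c (here (to (Models.faithful-labels M p q) i≡j))))
        <∣> go es (λ c → inject c ∘ there)

    -- The colour of `e` either is new or agrees with that of an edge in `σ`; a fresh label and the
    -- labels in use therefore exhaust all cases.
    split : ∀ {σ} e i → i ∉ map proj₂ σ → Forces ((e , i) ∷ σ) →
            All (λ j → Forces ((e , j) ∷ σ)) (deduplicate ℕ._≟_ (map proj₂ σ)) → Forces σ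
    split {σ} e i i∉σ new old {c} M with Any.any? (λ (e′ , _) → c e Fin.≟ c e′) σ
    ... | no ¬old  = new (extend M λ p → mk⇔
      (λ i≡j → contradiction (subst (_∈ map proj₂ σ) (sym i≡j) (∈-map⁺ proj₂ p)) i∉σ)
      (λ eq → contradiction (lose p eq) ¬old))
    ... | yes hit with find hit
    ...   | (e′ , j) , e′j∈σ , ce≡ce′ =
      All.lookup old (∈-deduplicate⁺ ℕ._≟_ (∈-map⁺ proj₂ e′j∈σ))
        (extend M λ q → subst (λ x → j ≡ _ ⇔ x ≡ c _) (sym ce≡ce′) (Models.faithful M e′j∈σ q))

    -- The fresh label `length σ` stands for a new colour; its freshness is checked, not proved.
    search : List Edge → ∀ σ → Maybe (Forces σ)
    search []       σ = nothing
    search (e ∷ es) σ = maybe′ (λ _ → search es σ) (branch es) (label σ e)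
      where
      close : List Edge → ∀ σ → Maybe (Forces σ)
      close es σ = findEquality σ <∣> findTrail σ <∣> search es σ

      branch : List Edge → Maybe (Forces σ)
      branch es = do
        fresh ← dec⇒maybe (¬? (DecMembership._∈?_ ℕ._≟_ (length σ) (map proj₂ σ)))
        new   ← close es ((e , length σ) ∷ σ)
        old   ← allJust (λ j → close es ((e , j) ∷ σ)) (deduplicate ℕ._≟_ (map proj₂ σ))
        just (split e (length σ) fresh new old)

allFinJust : ∀ {n} {B : Fin n → Set} → (∀ i → Maybe (B i)) → Maybe (∀ i → B i)
allFinJust {zero}  f = just λ ()
allFinJust {suc n} f =
  Maybe.zipWith (λ b bs → λ { zero → b ; (suc i) → bs i }) (f zero) (allFinJust (λ i → f (suc i)))

-- Certificates for a three-coloured star and a fourth colour.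

module _ {k : ℕ} (l : ℕ) where
  open Search {3 + l + 4} {k}

  -- The names 0, 1, 2 stand for the vertices p, q, r outside the star, the last four names for
  -- the centre v and the leaves a, b, c of the star, and the l names in between for those
  -- endpoints of the edge xy of a fourth colour that are not in the star.
  pq qr va vb vc : Edge
  pq = # 0 , # 1
  qr = # 1 , # 2
  va = (3 + l) ↑ʳ # 0 , (3 + l) ↑ʳ # 1
  vb = (3 + l) ↑ʳ # 0 , (3 + l) ↑ʳ # 2
  vc = (3 + l) ↑ʳ # 0 , (3 + l) ↑ʳ # 3

  -- Each entry contradicts an assumption: `pq` and `qr` differ, the star has three colours, and
  -- `xy` has a fourth.
  equalities : Edge → List (Edge × Edge)
  equalities xy = (pq , qr) ∷ (va , vb) ∷ (va , vc) ∷ (vb , vc) ∷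
                  (xy , va) ∷ (xy , vb) ∷ (xy , vc) ∷ []

  -- `P 5` has 4 edges, and the empty state is modelled by every symmetric colouring.
  Certificate : Edge → Set
  Certificate xy = Forces 4 (equalities xy) []

  -- The list is an order in which to branch on the edges; the orders below were found by
  -- experiment and keep the search trees at a few hundred nodes.
  certify : List Edge → ∀ xy → Maybe (Certificate xy)
  certify es xy = search 4 (equalities xy) (va ∷ vb ∷ vc ∷ xy ∷ es) []

-- Both ends of `xy` lie in the star, and `punchIn` ranges over the ends other than `i`. The search
-- runs during type checking: `from-just` is accepted only if it succeeds, and it never inspects
-- `k`.
certificate₀ : ∀ {k} i j → Certificate {k} 0 (3 ↑ʳ i , 3 ↑ʳ Fin.punchIn i j)
certificate₀ = from-just (allFinJust λ i → allFinJust λ j → certify 0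
  ((# 1 , # 5) ∷ (# 1 , # 4) ∷ (# 0 , # 6) ∷ (# 0 , # 1) ∷ (# 1 , # 2) ∷ (# 2 , # 6)
   ∷ (# 0 , # 2) ∷ (# 4 , # 5) ∷ (# 1 , # 3) ∷ (# 4 , # 6) ∷ (# 0 , # 3) ∷ [])
  (3 ↑ʳ i , 3 ↑ʳ Fin.punchIn i j))

-- The fourth colour is on an edge from the outside vertex 3 into the star.
certificate₁ : ∀ {k} i → Certificate {k} 1 (# 3 , 4 ↑ʳ i)
certificate₁ = from-just (allFinJust λ i → certify 1
  ((# 2 , # 3) ∷ (# 2 , # 5) ∷ (# 2 , # 7) ∷ (# 7 , # 3) ∷ (# 5 , # 3) ∷ (# 2 , # 6)
   ∷ (# 5 , # 7) ∷ (# 0 , # 3) ∷ (# 1 , # 2) ∷ (# 0 , # 5) ∷ (# 0 , # 1) ∷ (# 0 , #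
   7) ∷ (# 1 , # 6) ∷ (# 1 , # 5) ∷ (# 0 , # 2) ∷ (# 6 , # 3) ∷ [])
  (# 3 , 4 ↑ʳ i))

-- The edge of the fourth colour is disjoint from the star.
certificate₂ : ∀ {k} → Certificate {k} 2 (# 3 , # 4)
certificate₂ = from-just (certify 2
  ((# 7 , # 3) ∷ (# 6 , # 3) ∷ (# 8 , # 4) ∷ (# 6 , # 8) ∷ (# 6 , # 4) ∷ (# 1 , # 4)
   ∷ (# 1 , # 6) ∷ (# 1 , # 7) ∷ (# 1 , # 2) ∷ (# 0 , # 1) ∷ [])
  (# 3 , # 4))

-- Removal and pigeonhole for lists without repetition.

infixl 6 _∖_
_∖_ : ∀ {n} → List (Fin n) → List (Fin n) → List (Fin n)
xs ∖ []       = xs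
xs ∖ (y ∷ ys) = filter (λ x → ¬? (x Fin.≟ y)) xs ∖ ys

∈-∖⁻ : ∀ {n} {xs : List (Fin n)} ys {z} → z ∈ xs ∖ ys → z ∈ xs × z ∉ ys
∈-∖⁻ []       z∈ = z∈ , λ ()
∈-∖⁻ {xs = xs} (y ∷ ys) z∈ with ∈-∖⁻ ys z∈
... | z∈′ , z∉ys with ∈-filter⁻ (λ x → ¬? (x Fin.≟ y)) {xs = xs} z∈′
...   | z∈xs , z≢y = z∈xs , λ { (here z≡y) → z≢y z≡y ; (there z∈ys) → z∉ys z∈ys }

∈-∖⁺ : ∀ {n} {xs : List (Fin n)} ys {z} → z ∈ xs → z ∉ ys → z ∈ xs ∖ ys
∈-∖⁺ []       z∈ _  = z∈
∈-∖⁺ (y ∷ ys) z∈ z∉ = ∈-∖⁺ ys (∈-filter⁺ (λ x → ¬? (x Fin.≟ y)) z∈ (z∉ ∘ here)) (z∉ ∘ there)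

Unique-∖ : ∀ {n} {xs : List (Fin n)} ys → Unique xs → Unique (xs ∖ ys)
Unique-∖ []       xs! = xs!
Unique-∖ (y ∷ ys) xs! = Unique-∖ ys (Uniqueₚ.filter⁺ (λ x → ¬? (x Fin.≟ y)) xs!)

-- Each entry of `ys` removes at most one entry of `xs`, because `xs` has no repetitions.
length-∖ : ∀ {n} {xs : List (Fin n)} ys → Unique xs → length xs ≤ length ys + length (xs ∖ ys)
length-∖ []       xs! = ℕₚ.≤-refl
length-∖ (y ∷ ys) xs! = ℕₚ.≤-trans (length-remove xs!)
  (s≤s (length-∖ ys (Uniqueₚ.filter⁺ (λ x → ¬? (x Fin.≟ y)) xs!)))
  where
  length-remove : ∀ {xs} → Unique xs → length xs ≤ suc (length (filter (λ x → ¬? (x Fin.≟ y)) xs))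
  length-remove []                   = z≤n
  length-remove {x ∷ xs} (x∉xs ∷ xs!) with x Fin.≟ y
  ... | yes refl = s≤s (ℕₚ.≤-reflexive (sym (cong length
                     (Listₚ.filter-all (λ x → ¬? (x Fin.≟ y)) (All.map ≢-sym x∉xs)))))
  ... | no  _    = s≤s (length-remove xs!)

length-allFin-∖ : ∀ {n} (ys : List (Fin n)) → n ≤ length ys + length (allFin n ∖ ys)
length-allFin-∖ {n} ys = subst (_≤ length ys + length (allFin n ∖ ys))
  (Listₚ.length-tabulate {n = n} (λ i → i)) (length-∖ ys (Uniqueₚ.allFin⁺ n))

length-∖-∈ : ∀ {n} {xs : List (Fin n)} {y} → y ∈ xs → length (xs ∖ (y ∷ [])) < length xs
length-∖-∈ {xs = xs} {y} y∈xs =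
  Listₚ.filter-notAll (λ x → ¬? (x Fin.≟ y)) xs (Any.map (λ y≡x x≢y → x≢y (sym y≡x)) y∈xs)

fresh : ∀ {n} (xs : List (Fin n)) → length xs < n → ∃ λ i → i ∉ xs
fresh {n} xs xs<n with allFin n ∖ xs in eq
... | i ∷ _ = i , proj₂ (∈-∖⁻ {xs = allFin n} xs (subst (i ∈_) (sym eq) (here refl)))
... | []    = contradiction
  (ℕₚ.≤-trans (length-allFin-∖ xs)
    (ℕₚ.≤-reflexive (trans (cong (λ zs → length xs + length zs) eq) (ℕₚ.+-identityʳ _))))
  (ℕₚ.<⇒≱ xs<n)

-- Induction on `js`: either the fibre over the first value has more than `s` elements, or
-- discarding it loses at most `s` and the bound passes to the remaining values.
pigeonhole : ∀ {n k} s (f : Fin n → Fin k) {xs} js → Unique xs → All (λ x → f x ∈ js) xs →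
             length js * s < length xs →
             ∃₂ λ j ys → j ∈ js × s < length ys × Unique ys × All (λ y → f y ≡ j) ys
pigeonhole s f {[]}     []       _   _        ()
pigeonhole s f {_ ∷ _}  []       _   (() ∷ _)
pigeonhole s f {xs}     (j ∷ js) xs! f∈ bound
  with ys ← filter (λ x → f x Fin.≟ j) xs in eq
  with s ℕ.<? length ys
... | yes s<ys = j , ys , here refl , s<ys , subst Unique eq (Uniqueₚ.filter⁺ f≟j xs!) ,
                 subst (All _) eq (Allₚ.all-filter f≟j xs)
  where
  f≟j : ∀ x → Dec (f x ≡ j)
  f≟j x = f x Fin.≟ j
... | no ¬s<ys =
  let j′ , zs , j′∈js , rest = pigeonhole s f js (Uniqueₚ.filter⁺ f≢j xs!) in-js smaller
  in j′ , zs , there j′∈js , rest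
  where
  f≟j = λ x → f x Fin.≟ j
  f≢j = λ x → ¬? (f x Fin.≟ j)

  in-js : All (λ x → f x ∈ js) (filter f≢j xs)
  in-js = All.tabulate λ x∈ → let x∈xs , fx≢j = ∈-filter⁻ f≢j {xs = xs} x∈ in
    Any.tail fx≢j (All.lookup f∈ x∈xs)

  length-split : ∀ xs → length xs ≡ length (filter f≟j xs) + length (filter f≢j xs)
  length-split []       = refl
  length-split (x ∷ xs) with f x Fin.≟ j
  ... | yes _ = cong suc (length-split xs)
  ... | no  _ = trans (cong suc (length-split xs)) (sym (ℕₚ.+-suc _ _))

  open ℕₚ.≤-Reasoning
  smaller : length js * s < length (filter f≢j xs)
  smaller = ℕₚ.+-cancelˡ-< s _ _ (begin-strict
    s + length js * s                             <⟨ bound ⟩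
    length xs                                     ≡⟨ length-split xs ⟩
    length (filter f≟j xs) + length (filter f≢j xs)
      ≤⟨ ℕₚ.+-monoˡ-≤ _ (subst (λ ys → length ys ≤ s) (sym eq) (ℕₚ.≮⇒≥ ¬s<ys)) ⟩
    s + length (filter f≢j xs)                    ∎)

-- Serves the clique of a pineapple, whose vertices are the first `length xs` positions, before the
-- pendent vertices `ys`.
AllPairs-lookup-++ : ∀ {A : Set} {R : A → A → Set} → Symmetric R → ∀ {xs} ys → AllPairs R xs →
  ∀ {i j : Fin (length (xs ++ ys))} → toℕ i < length xs → toℕ j < length xs → i ≢ j →
  R (lookup (xs ++ ys) i) (lookup (xs ++ ys) j)
AllPairs-lookup-++ {R = R} R-sym ys = go
  where
  All-lookup-++ : ∀ {P : _ → Set} {xs} → All P xs → (i : Fin (length (xs ++ ys))) →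
                  toℕ i < length xs → P (lookup (xs ++ ys) i)
  All-lookup-++ (p ∷ _)  zero    _       = p
  All-lookup-++ (_ ∷ ps) (suc i) (s≤s i<) = All-lookup-++ ps i i<

  go : ∀ {xs} → AllPairs R xs → ∀ {i j : Fin (length (xs ++ ys))} →
       toℕ i < length xs → toℕ j < length xs → i ≢ j →
       R (lookup (xs ++ ys) i) (lookup (xs ++ ys) j)
  go (_ ∷ _)   {zero}  {zero}  _        _        i≢j = contradiction refl i≢j
  go (rs ∷ _)  {zero}  {suc j} _        (s≤s j<) _   = All-lookup-++ rs j j<
  go (rs ∷ _)  {suc i} {zero}  (s≤s i<) _        _   = R-sym (All-lookup-++ rs i i<)
  go (_ ∷ rss) {suc i} {suc j} (s≤s i<) (s≤s j<) i≢j = go rss i< j< (i≢j ∘ cong suc)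

AllPairs-tabulate : ∀ {A : Set} {R : A → A → Set} {xs} → Unique xs →
                    (∀ {x y} → x ∈ xs → y ∈ xs → x ≢ y → R x y) → AllPairs R xs
AllPairs-tabulate []           f = []
AllPairs-tabulate (x∉xs ∷ xs!) f =
  All.tabulate (λ y∈xs → f (here refl) (there y∈xs) (All.lookup x∉xs y∈xs)) ∷
  AllPairs-tabulate xs! (λ x∈xs y∈xs → f (there x∈xs) (there y∈xs))

-- Building monochromatic pineapples.

module _ {n k : ℕ} (χ : EdgeColouring (K n) k) where
  open EdgeColouring χ

  MonochromaticPA : ℕ → ℕ → Set
  MonochromaticPA t ω = ∃ λ (φ : Copy (PA t ω) (K n)) → Monochromatic χ φ

  -- The order hub, rest of the clique, pendent vertices matches the numbering of the vertices of
  -- `PA`.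
  PA-copy : ∀ {d h qs ps} → Unique (h ∷ qs ++ ps) → All (λ x → colour h x ≡ d) (qs ++ ps) →
            AllPairs (λ x y → colour x y ≡ d) qs →
            MonochromaticPA (suc (length (qs ++ ps))) (suc (length qs))
  PA-copy {d} {h} {qs} {ps} vs! hub clique = φ , d , λ {u} {v} → mono u v
    where
    vs = h ∷ qs ++ ps
    φ : Copy (PA (suc (length (qs ++ ps))) (suc (length qs))) (K n)
    φ = record
      { embed     = lookup vs
      ; injective = lookup-injective vs!
      ; preserves = λ (u≢v , _) eq → u≢v (lookup-injective vs! eq)
      }

    R-sym : Symmetric (λ x y → colour x y ≡ d)
    R-sym eq = trans (colourSym _ _) eq

    star : ∀ u v → toℕ u ≡ 0 → u ≢ v → colour (lookup vs u) (lookup vs v) ≡ d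
    star zero zero    _ u≢v = contradiction refl u≢v
    star zero (suc v) _ _   = All.lookup hub (∈-lookup v)

    mono : ∀ u v → Graph.Adj (PA _ _) u v → colour (lookup vs u) (lookup vs v) ≡ d
    mono u v (u≢v , inj₁ (u< , v<))            =
      AllPairs-lookup-++ R-sym ps (Allₚ.++⁻ˡ qs hub ∷ clique) u< v< u≢v
    mono u v (u≢v , inj₂ (inj₁ (u≡0 , _)))     = star u v u≡0 u≢v
    mono u v (u≢v , inj₂ (inj₂ (v≡0 , _)))     = R-sym (star v u v≡0 (≢-sym u≢v))

  -- Take `ω` clique vertices from `qs`. At least `t ∸ ω` vertices of `ns` survive their removal and
  -- become pendent. The hub accounts for the successors in the conclusion.
  PA-in-neighbourhood : ∀ {d h qs ns t ω} → Unique (h ∷ qs) → All (λ x → colour h x ≡ d) qs →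
    AllPairs (λ x y → colour x y ≡ d) qs → Unique (h ∷ ns) → All (λ x → colour h x ≡ d) ns →
    ω ≤ length qs → ω ≤ t → t ≤ length ns → MonochromaticPA (suc t) (suc ω)
  PA-in-neighbourhood {d} {h} {qs} {ns} {t} {ω} (h∉qs ∷ qs!) hub clique (h∉ns ∷ ns!) nbr ω≤ ω≤t t≤ =
    subst₂ MonochromaticPA (cong suc len-total) (cong suc len-qs′)
      (PA-copy {ps = ps} (Allₚ.++⁺ (Allₚ.take⁺ ω h∉qs) (All.tabulate (All.lookup h∉ns ∘ ps⊆))
                ∷ Uniqueₚ.++⁺ (AllPairsₚ.take⁺ ω qs!) ps! disjoint)
               (Allₚ.++⁺ (Allₚ.take⁺ ω hub) (All.tabulate (All.lookup nbr ∘ ps⊆)))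
               (AllPairsₚ.take⁺ ω clique))
    where
    qs′ = take ω qs
    ps  = take (t ∸ ω) (ns ∖ qs′)

    len-qs′ : length qs′ ≡ ω
    len-qs′ = trans (Listₚ.length-take ω qs) (ℕₚ.m≤n⇒m⊓n≡m ω≤)

    enough : t ∸ ω ≤ length (ns ∖ qs′)
    enough = ℕₚ.m≤n+o⇒m∸n≤o t ω (subst (λ l → t ≤ l + length (ns ∖ qs′)) len-qs′
      (ℕₚ.≤-trans t≤ (length-∖ qs′ ns!)))

    len-total : length (qs′ ++ ps) ≡ t
    len-total = trans (Listₚ.length-++ qs′) (trans
      (cong₂ _+_ len-qs′ (trans (Listₚ.length-take (t ∸ ω) (ns ∖ qs′)) (ℕₚ.m≤n⇒m⊓n≡m enough)))
      (ℕₚ.m+[n∸m]≡n ω≤t))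

    ps! : Unique ps
    ps! = AllPairsₚ.take⁺ (t ∸ ω) (Unique-∖ qs′ ns!)

    ps-∈ : ∀ {x} → x ∈ ps → x ∈ ns × x ∉ qs′
    ps-∈ x∈ps = ∈-∖⁻ qs′ (∈-take x∈ps)
      where
      ∈-take : ∀ {x} → x ∈ ps → x ∈ ns ∖ qs′
      ∈-take = All.lookup (Allₚ.take⁺ (t ∸ ω) (All.tabulate {xs = ns ∖ qs′} (λ x∈ → x∈)))

    ps⊆ : ∀ {x} → x ∈ ps → x ∈ ns
    ps⊆ = proj₁ ∘ ps-∈

    disjoint : ∀ {x} → ¬ (x ∈ qs′ × x ∈ ps)
    disjoint (x∈qs′ , x∈ps) = proj₂ (ps-∈ x∈ps) x∈qs′

  PA-in-clique : ∀ {d xs t ω} → Unique xs →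
    (∀ {x y} → x ∈ xs → y ∈ xs → x ≢ y → colour x y ≡ d) →
    ω ≤ t → t < length xs → MonochromaticPA (suc t) (suc ω)
  PA-in-clique {xs = x ∷ xs} xs! mono ω≤t (s≤s t≤) with AllPairs-tabulate xs! mono
  ... | hub ∷ clique = PA-in-neighbourhood xs! hub clique xs! hub (ℕₚ.≤-trans ω≤t t≤) ω≤t t≤

-- From certificates to rainbow paths.

locate : ∀ {n} (xs : List (Fin n)) x → (∃ λ i → x ≡ lookup xs i) ⊎ x ∉ xs
locate xs x with DecMembership._∈?_ Fin._≟_ x xs
... | yes x∈xs = inj₁ (Any.index x∈xs , Anyₚ.lookup-index x∈xs)
... | no  x∉xs = inj₂ x∉xs

module _ {n k : ℕ} (χ : EdgeColouring (K n) k) where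
  open EdgeColouring χ

  RainbowP : ℕ → Set
  RainbowP m = ∃ λ (φ : Copy (P m) (K n)) → Rainbow χ φ

  -- `env` interprets names as vertices. The colouring pulled back along it models the empty state;
  -- once the equalities are refuted, only a rainbow path remains, and it is mapped back by `env`.
  forces⇒rainbow : ∀ {l} (env : List (Fin n)) → Unique env → let open Search {length env} {k} in
    ∀ {eqs} → Forces l eqs [] →
    All (uncurry _≢_) (map (λ ((a , b) , (x , y)) → colour (lookup env a) (lookup env b) ,
                                                    colour (lookup env x) (lookup env y)) eqs) →
    RainbowP (suc l)
  forces⇒rainbow env env! forces differ with forces {λ (a , b) → colour (lookup env a) (lookup env b)}
    (record { c-sym = λ _ → colourSym _ _ ; faithful = λ () })
  ... | inj₂ equal = contradiction equal (Allₚ.All¬⇒¬Any (Allₚ.map⁻ differ))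
  ... | inj₁ (vs , len , vs! , cs!) =
    subst RainbowP (trans (Listₚ.length-map (lookup env) vs) len)
      (trail⇒copy χ (map (lookup env) vs)
        ( Uniqueₚ.map⁺ (lookup-injective env!) vs!
        , subst Unique (trans (Listₚ.map-∘ (steps vs))
                         (cong (map (uncurry colour)) (sym (steps-map (lookup env) vs)))) cs!))

  Sees : Fin n → Fin k → Set
  Sees v i = ∃ λ u → v ≢ u × colour v u ≡ i

  sees? : ∀ v i → Dec (Sees v i)
  sees? v i = Finₚ.any? λ u → ¬? (v Fin.≟ u) ×-dec (colour v u Fin.≟ i)

  module _ {v a b c : Fin n} (abc : All (v ≢_) (a ∷ b ∷ c ∷ []))
           (colours! : Unique (colour v a ∷ colour v b ∷ colour v c ∷ [])) where

    star : List (Fin n)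
    star = v ∷ a ∷ b ∷ c ∷ []

    star! : Unique star
    -- The leaves are distinct because their edges to `v` have distinct colours.
    star! = abc ∷ AllPairs.map (λ neq eq → neq (cong (colour v) eq)) (AllPairsₚ.map⁻ colours!)

    -- The number of ends of `xy` inside the star decides which of the three certificates applies.
    star⇒rainbow : ∀ x y p q r → x ≢ y →
      All (colour x y ≢_) (colour v a ∷ colour v b ∷ colour v c ∷ []) →
      Unique (p ∷ q ∷ r ∷ []) → All (_∉ x ∷ y ∷ star) (p ∷ q ∷ r ∷ []) →
      colour p q ≢ colour q r → RainbowP 5
    star⇒rainbow x y p q r x≢y xy≢ pqr! pqr∉ pq≢qr = cases (locate star x) (locate star y)
      where
      unused : ∀ {xs} → Unique xs → All (_∈ x ∷ y ∷ star) xs → Unique (p ∷ q ∷ r ∷ xs)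
      unused xs! xs∈ = Uniqueₚ.++⁺ pqr! xs! λ (z∈pqr , z∈xs) →
        All.lookup pqr∉ z∈pqr (All.lookup xs∈ z∈xs)

      star⊆ : All (_∈ x ∷ y ∷ star) star
      star⊆ = All.tabulate (there ∘ there)

      -- `e` is the colour of the fourth edge as the certificate writes it, possibly reversed or
      -- through positions in `star`.
      differ : ∀ {e} → e ≡ colour x y → All (uncurry _≢_)
        ((colour p q , colour q r) ∷ (colour v a , colour v b) ∷ (colour v a , colour v c) ∷
         (colour v b , colour v c) ∷ (e , colour v a) ∷ (e , colour v b) ∷ (e , colour v c) ∷ [])
      differ refl = assemble colours! xy≢
        where
        assemble : ∀ {α β γ δ} → Unique (α ∷ β ∷ γ ∷ []) → All (δ ≢_) (α ∷ β ∷ γ ∷ []) →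
                   All (uncurry _≢_) ((colour p q , colour q r) ∷ (α , β) ∷ (α , γ) ∷ (β , γ) ∷
                                      (δ , α) ∷ (δ , β) ∷ (δ , γ) ∷ [])
        assemble ((αβ ∷ αγ ∷ []) ∷ (βγ ∷ []) ∷ _) (δα ∷ δβ ∷ δγ ∷ []) =
          pq≢qr ∷ αβ ∷ αγ ∷ βγ ∷ δα ∷ δβ ∷ δγ ∷ []

      mixed : ∀ {w} i → w ∉ star → w ∈ x ∷ y ∷ star → colour w (lookup star i) ≡ colour x y →
              RainbowP 5
      mixed {w} i w∉ w∈ eq = forces⇒rainbow (p ∷ q ∷ r ∷ w ∷ star)
        (unused (Allₚ.¬Any⇒All¬ _ w∉ ∷ star!) (w∈ ∷ star⊆)) (certificate₁ i) (differ eq)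

      cases : (∃ λ i → x ≡ lookup star i) ⊎ x ∉ star → (∃ λ i → y ≡ lookup star i) ⊎ y ∉ star →
              RainbowP 5
      cases (inj₁ (i , x≡)) (inj₁ (j , y≡)) =
        forces⇒rainbow (p ∷ q ∷ r ∷ star) (unused star! star⊆) (certificate₀ i (Fin.punchOut i≢j))
          (differ (trans (cong (λ z → colour (lookup star i) (lookup star z)) (Finₚ.punchIn-punchOut i≢j))
                         (sym (cong₂ colour x≡ y≡))))
        where
        i≢j : i ≢ j
        i≢j refl = x≢y (trans x≡ (sym y≡))
      cases (inj₁ (i , refl)) (inj₂ y∉) = mixed i y∉ (there (here refl)) (colourSym _ _)
      cases (inj₂ x∉) (inj₁ (j , y≡)) = mixed j x∉ (here refl) (cong (colour x) (sym y≡))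
      cases (inj₂ x∉) (inj₂ y∉) = forces⇒rainbow (p ∷ q ∷ r ∷ x ∷ y ∷ star)
        (unused ((x≢y ∷ Allₚ.¬Any⇒All¬ _ x∉) ∷ Allₚ.¬Any⇒All¬ _ y∉ ∷ star!)
                (here refl ∷ there (here refl) ∷ star⊆))
        certificate₂ (differ refl)

-- Upper bound: a vertex that sees three colours.

module _ {n ω t : ℕ} (χ : EdgeColouring (K n) (suc ω)) (3≤ω : 3 ≤ ω) (ω<t : ω < t)
         (large : ω * t < n) where
  open EdgeColouring χ

  Colour : Set
  Colour = Fin (suc ω)

  -- Both `ω` and `t` are one less than in the theorem, so `large` says that `n` exceeds the number
  -- of vertices in the extremal colouring.
  Target : Set
  Target = RainbowP χ 5 ⊎ MonochromaticPA χ (suc t) (suc ω)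

  three-seen : ∀ {v i j l} → Sees χ v i → Sees χ v j → Sees χ v l → i ≢ j → i ≢ l → j ≢ l → Target
  three-seen {v} (a , va , refl) (b , vb , refl) (c , vc , refl) i≢j i≢l j≢l
    -- There are at least four colours, and exactness puts one outside these three on an edge `xy`.
    with d , d∉ ← fresh (colour v a ∷ colour v b ∷ colour v c ∷ []) (s≤s 3≤ω)
    with x , y , x≢y , refl ← exact d = decide
      (Finₚ.any? λ p → Finₚ.any? λ q → Finₚ.any? λ r →
        DecUnique.unique? Fin._≟_ (p ∷ q ∷ r ∷ []) ×-dec
        All.all? (λ z → ¬? (DecMembership._∈?_ Fin._≟_ z special)) (p ∷ q ∷ r ∷ []) ×-dec
        ¬? (colour p q Fin.≟ colour q r))
    where
    abc : All (v ≢_) (a ∷ b ∷ c ∷ [])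
    abc = va ∷ vb ∷ vc ∷ []

    abc! : Unique (colour v a ∷ colour v b ∷ colour v c ∷ [])
    abc! = (i≢j ∷ i≢l ∷ []) ∷ (j≢l ∷ []) ∷ [] ∷ []

    special others : List (Fin n)
    special = x ∷ y ∷ v ∷ a ∷ b ∷ c ∷ []
    others  = allFin n ∖ special

    t<others : t < length others
    t<others = ℕₚ.+-cancelˡ-< 6 t _ (begin-strict
      6 + t               ≡⟨ ℕₚ.+-comm 6 t ⟩
      -- `6 ≤ t + t` because `3 ≤ t`.
      t + 6               ≤⟨ ℕₚ.+-monoʳ-≤ t (ℕₚ.+-mono-≤ 3≤t (ℕₚ.m≤n⇒m≤n+o 0 3≤t)) ⟩
      3 * t               ≤⟨ ℕₚ.*-monoˡ-≤ t 3≤ω ⟩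
      ω * t               <⟨ large ⟩
      n                   ≤⟨ length-allFin-∖ special ⟩
      6 + length others   ∎)
      where
      open ℕₚ.≤-Reasoning
      3≤t = ℕₚ.≤-trans 3≤ω (ℕₚ.<⇒≤ ω<t)

    Bad : Set
    Bad = ∃ λ p → ∃ λ q → ∃ λ r → Unique (p ∷ q ∷ r ∷ []) × All (_∉ special) (p ∷ q ∷ r ∷ []) ×
                                  colour p q ≢ colour q r

    decide : Dec Bad → Target
    decide (yes (p , q , r , pqr! , pqr∉ , pq≢qr)) = inj₁
      (star⇒rainbow χ abc abc! x y p q r x≢y (Allₚ.¬Any⇒All¬ _ d∉) pqr! pqr∉ pq≢qr)
    decide (no ¬bad) = inj₂ (monochromatic others refl t<others)
      where
      same : ∀ {p q r} → p ∈ others → q ∈ others → r ∈ others → p ≢ q → p ≢ r → q ≢ r →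
             colour p q ≡ colour q r
      same {p} {q} {r} p∈ q∈ r∈ p≢q p≢r q≢r =
        decidable-stable (colour p q Fin.≟ colour q r) λ pq≢qr →
          ¬bad (p , q , r , (p≢q ∷ p≢r ∷ []) ∷ (q≢r ∷ []) ∷ [] ∷ [] ,
                avoid p∈ ∷ avoid q∈ ∷ avoid r∈ ∷ [] , pq≢qr)
        where
        avoid : ∀ {z} → z ∈ others → z ∉ special
        avoid = proj₂ ∘ ∈-∖⁻ {xs = allFin n} special

      -- Adjacent edges agree, so every edge at `z` has the colour of the edge from `z` to `z′`, and
      -- every other edge is adjacent to one at `z`. Naming the list `xs` exposes these two
      -- vertices.
      monochromatic : ∀ xs → others ≡ xs → t < length xs → MonochromaticPA χ (suc t) (suc ω)
      monochromatic (z ∷ [])       _  (s≤s z≤n) = contradiction ω<t λ ()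
      monochromatic xs@(z ∷ z′ ∷ _) eq t<xs =
        PA-in-clique χ (subst Unique eq xs!) constant (ℕₚ.<⇒≤ ω<t) t<xs
        where
        xs! : Unique others
        xs! = Unique-∖ special (Uniqueₚ.allFin⁺ n)

        ∈others : ∀ {u} → u ∈ xs → u ∈ others
        ∈others = subst (_ ∈_) (sym eq)

        z≢z′ : z ≢ z′
        z≢z′ with (z≢z′ ∷ _) ∷ _ ← subst Unique eq xs! = z≢z′

        from-z : ∀ {u} → u ∈ xs → z ≢ u → colour z u ≡ colour z z′
        from-z {u} u∈ z≢u with z′ Fin.≟ u
        ... | yes refl = refl
        ... | no z′≢u  = sym (trans (colourSym z z′)
          (same (∈others (there (here refl))) (∈others (here refl)) (∈others u∈)
                (≢-sym z≢z′) z′≢u z≢u))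

        constant : ∀ {u w} → u ∈ xs → w ∈ xs → u ≢ w → colour u w ≡ colour z z′
        constant {u} {w} u∈ w∈ u≢w with z Fin.≟ u | z Fin.≟ w
        ... | yes refl | _        = from-z w∈ u≢w
        ... | no z≢u   | yes refl = trans (colourSym u z) (from-z u∈ z≢u)
        ... | no z≢u   | no z≢w   = trans (colourSym u w) (trans
          (sym (same (∈others (here refl)) (∈others w∈) (∈others u∈) z≢w z≢u (≢-sym u≢w)))
          (from-z w∈ z≢w))

  three-seen? : Dec (∃ λ v → ∃ λ i → ∃ λ j → ∃ λ l →
    (Sees χ v i × Sees χ v j × Sees χ v l) × (i ≢ j × i ≢ l × j ≢ l))
  three-seen? = Finₚ.any? λ v → Finₚ.any? λ i → Finₚ.any? λ j → Finₚ.any? λ l →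
    (sees? χ v i ×-dec sees? χ v j ×-dec sees? χ v l) ×-dec
    (¬? (i Fin.≟ j) ×-dec ¬? (i Fin.≟ l) ×-dec ¬? (j Fin.≟ l))

  -- Upper bound: at most two colours at each vertex.

  module LocallyTwoColoured
    (two : ∀ {v i j l} → Sees χ v i → Sees χ v j → i ≢ j → Sees χ v l → l ≡ i ⊎ l ≡ j) where

    sees-edge : ∀ {u w} → u ≢ w → Sees χ u (colour u w)
    sees-edge u≢w = _ , u≢w , refl

    sees-edge′ : ∀ {u w} → u ≢ w → Sees χ w (colour u w)
    sees-edge′ u≢w = _ , ≢-sym u≢w , colourSym _ _

    representative : ∀ i → ∃ λ v → Sees χ v i
    representative i = let u , w , u≢w , eq = exact i in u , w , u≢w , eq

    sees-other⇒≢ : ∀ {v d d′ e x} → Sees χ v d → Sees χ v d′ → d ≢ d′ →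
                   e ∉ d ∷ d′ ∷ [] → Sees χ x e → v ≢ x
    sees-other⇒≢ vd vd′ d≢d′ e∉ xe refl with two vd vd′ d≢d′ xe
    ... | inj₁ e≡d  = e∉ (here e≡d)
    ... | inj₂ e≡d′ = e∉ (there (here e≡d′))

    -- The colour sets of the vertices pairwise intersect, and {d , d′}, {d , e}, {d , f}
    -- form a sunflower, so its core d belongs to all of them.
    sunflower : ∀ {v d d′ e f x y} → Sees χ v d → Sees χ v d′ → d ≢ d′ →
                e ∉ d ∷ d′ ∷ [] → f ∉ e ∷ d ∷ d′ ∷ [] → Sees χ x e → Sees χ y f →
                colour v x ≡ d → ∀ w → Sees χ w d
    sunflower {v} {d} {d′} {e} {f} {x} {y} vd vd′ d≢d′ e∉ f∉ xe yf vx≡d = all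
      where
      e≢d  = e∉ ∘ here
      e≢d′ = e∉ ∘ there ∘ here
      f≢e  = f∉ ∘ here
      f≢d  = f∉ ∘ there ∘ here
      f≢d′ = f∉ ∘ there ∘ there ∘ here

      v≢x : v ≢ x
      v≢x = sees-other⇒≢ vd vd′ d≢d′ e∉ xe

      v≢y : v ≢ y
      v≢y = sees-other⇒≢ vd vd′ d≢d′ (f∉ ∘ there) yf

      xd : Sees χ x d
      xd = subst (Sees χ x) vx≡d (sees-edge′ v≢x)

      x≢y : x ≢ y
      x≢y refl with two xd xe (≢-sym e≢d) yf
      ... | inj₁ f≡d = f≢d f≡d
      ... | inj₂ f≡e = f≢e f≡e

      yd : Sees χ y d
      yd with two vd vd′ d≢d′ (sees-edge v≢y)
      ... | inj₁ vy≡d  = subst (Sees χ y) vy≡d (sees-edge′ v≢y)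
      -- Otherwise `y` sees only `f` and `d′` while `x` sees only `d` and `e`, which leaves no
      -- colour for the edge between them.
      ... | inj₂ vy≡d′ with two xd xe (≢-sym e≢d) (sees-edge x≢y)
                          | two yf (subst (Sees χ y) vy≡d′ (sees-edge′ v≢y)) f≢d′ (sees-edge′ x≢y)
      ...   | inj₁ p | inj₁ q = contradiction (trans (sym q) p) f≢d
      ...   | inj₁ p | inj₂ q = contradiction (trans (sym p) q) d≢d′
      ...   | inj₂ p | inj₁ q = contradiction (trans (sym q) p) f≢e
      ...   | inj₂ p | inj₂ q = contradiction (trans (sym p) q) e≢d′

      all : ∀ w → Sees χ w d
      all w with v Fin.≟ w | x Fin.≟ w | y Fin.≟ w
      ... | yes refl | _        | _        = vd
      ... | no _     | yes refl | _        = xd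
      ... | no _     | no _     | yes refl = yd
      ... | no v≢w   | no x≢w   | no y≢w
        with two vd vd′ d≢d′ (sees-edge v≢w) | two xd xe (≢-sym e≢d) (sees-edge x≢w)
           | two yd yf (≢-sym f≢d) (sees-edge y≢w)
      ...   | inj₁ p | _      | _      = subst (Sees χ w) p (sees-edge′ v≢w)
      ...   | inj₂ _ | inj₁ p | _      = subst (Sees χ w) p (sees-edge′ x≢w)
      ...   | inj₂ _ | inj₂ _ | inj₁ p = subst (Sees χ w) p (sees-edge′ y≢w)
      -- Here `w` would see the three distinct colours `d′`, `e` and `f`.
      ...   | inj₂ p | inj₂ q | inj₂ r
        with two (subst (Sees χ w) p (sees-edge′ v≢w)) (subst (Sees χ w) q (sees-edge′ x≢w))
                 (≢-sym e≢d′) (subst (Sees χ w) r (sees-edge′ y≢w))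
      ...     | inj₁ f≡d′ = contradiction f≡d′ f≢d′
      ...     | inj₂ f≡e  = contradiction f≡e f≢e

    -- A third colour `e` and a fourth `f` exist. The edge from `v` to a vertex seeing `e` has
    -- colour `d` or `d′`, and this colour is the core of the sunflower.
    core : ∀ {v d d′} → Sees χ v d → Sees χ v d′ → d ≢ d′ → ∃ λ c → ∀ w → Sees χ w c
    core {v} {d} {d′} vd vd′ d≢d′
      with e , e∉ ← fresh (d ∷ d′ ∷ []) (s≤s (ℕₚ.<⇒≤ 3≤ω))
      with f , f∉ ← fresh (e ∷ d ∷ d′ ∷ []) (s≤s 3≤ω)
      with x , xe ← representative e
      with y , yf ← representative f
      with two vd vd′ d≢d′ (sees-edge (sees-other⇒≢ vd vd′ d≢d′ e∉ xe))
    ... | inj₁ vx≡d  = d , sunflower vd vd′ d≢d′ e∉ f∉ xe yf vx≡d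
    ... | inj₂ vx≡d′ = d′ , sunflower vd′ vd (≢-sym d≢d′) (e∉ ∘ flip₁) (f∉ ∘ flip₂) xe yf vx≡d′
      where
      flip₁ : ∀ {g} → g ∈ d′ ∷ d ∷ [] → g ∈ d ∷ d′ ∷ []
      flip₁ (here p)         = there (here p)
      flip₁ (there (here p)) = here p

      flip₂ : ∀ {g} → g ∈ e ∷ d′ ∷ d ∷ [] → g ∈ e ∷ d ∷ d′ ∷ []
      flip₂ (here p)  = here p
      flip₂ (there p) = there (flip₁ p)

    -- If some vertex `v` sees two colours, `core` applies; otherwise all edges at `v` share one
    -- colour, which thereby reaches every vertex.
    dominating : ∃ λ d → ∀ w → Sees χ w d
    dominating with v , u , v≢u , _ ← exact zero
      with Finₚ.any? (λ u′ → ¬? (v Fin.≟ u′) ×-dec ¬? (colour v u Fin.≟ colour v u′))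
    ... | yes (u′ , v≢u′ , neq) = core (sees-edge v≢u) (sees-edge v≢u′) neq
    ... | no constant           = colour v u , all
      where
      all : ∀ w → Sees χ w (colour v u)
      all w with v Fin.≟ w
      ... | yes refl = sees-edge v≢u
      ... | no  v≢w  = subst (Sees χ w)
        (sym (decidable-stable (_ Fin.≟ _) λ neq → constant (w , v≢w , neq))) (sees-edge′ v≢w)

    -- Colour classes joined by the dominating colour.

    module Dominated {d : Colour} (dom : ∀ w → Sees χ w d) where

      -- Besides `d` a vertex sees at most one colour, so the classes of different colours are
      -- disjoint.
      apart : ∀ {u w i j} → Sees χ u i → i ≢ d → Sees χ w j → j ≢ d → i ≢ j → u ≢ w
      apart ui i≢d wj j≢d i≢j refl with two (dom _) ui (≢-sym i≢d) wj
      ... | inj₁ j≡d = j≢d j≡d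
      ... | inj₂ j≡i = i≢j (sym j≡i)

      -- The edge has a colour in `d`, `i` as seen from `u` and in `d`, `j` as seen from `w`; only
      -- `d` is common.
      cross : ∀ {u w i j} → Sees χ u i → i ≢ d → Sees χ w j → j ≢ d → i ≢ j → colour u w ≡ d
      cross {u} {w} ui i≢d wj j≢d i≢j
        with two (dom _) ui (≢-sym i≢d) (sees-edge u≢w) | two (dom _) wj (≢-sym j≢d) (sees-edge′ u≢w)
        where
        u≢w : u ≢ w
        u≢w = apart ui i≢d wj j≢d i≢j
      ... | inj₁ p | _      = p
      ... | inj₂ _ | inj₁ q = q
      ... | inj₂ p | inj₂ q = contradiction (trans (sym p) q) i≢j

      rep : Colour → Fin n
      rep i = proj₁ (representative i)

      rep-sees : ∀ i → Sees χ (rep i) i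
      rep-sees i = proj₂ (representative i)

      reps! : ∀ {is} → Unique is → All (_≢ d) is → Unique (map rep is)
      reps! is! is≢d = AllPairsₚ.map⁺ (AllPairs-tabulate is! λ {i} {j} i∈ j∈ →
        apart (rep-sees i) (All.lookup is≢d i∈) (rep-sees j) (All.lookup is≢d j∈))

      reps-clique : ∀ {is} → Unique is → All (_≢ d) is →
                    AllPairs (λ u w → colour u w ≡ d) (map rep is)
      reps-clique is! is≢d = AllPairsₚ.map⁺ (AllPairs-tabulate is! λ {i} {j} i∈ j∈ →
        cross (rep-sees i) (All.lookup is≢d i∈) (rep-sees j) (All.lookup is≢d j∈))

      reps-apart : ∀ {u i is} → Sees χ u i → i ≢ d → All (_≢ d) is → All (i ≢_) is →
                   All (u ≢_) (map rep is)
      reps-apart ui i≢d is≢d i∉ = Allₚ.map⁺ (All.zipWith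
        (λ {j} (j≢d , i≢j) → apart ui i≢d (rep-sees j) j≢d i≢j) (is≢d , i∉))

      reps-cross : ∀ {u i is} → Sees χ u i → i ≢ d → All (_≢ d) is → All (i ≢_) is →
                   All (λ w → colour u w ≡ d) (map rep is)
      reps-cross ui i≢d is≢d i∉ = Allₚ.map⁺ (All.zipWith
        (λ {j} (j≢d , i≢j) → cross ui i≢d (rep-sees j) j≢d i≢j) (is≢d , i∉))

      remaining : List Colour → List Colour
      remaining is = allFin (suc ω) ∖ is

      remaining! : ∀ is → Unique (remaining is)
      remaining! is = Unique-∖ is (Uniqueₚ.allFin⁺ (suc ω))

      remaining-≢ : ∀ is {i} → i ∈ is → All (i ≢_) (remaining is)
      remaining-≢ is i∈ = All.tabulate λ j∈ → λ { refl → proj₂ (∈-∖⁻ {xs = allFin (suc ω)} is j∈) i∈ }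

      ω≤t : ω ≤ t
      ω≤t = ℕₚ.<⇒≤ ω<t

      -- Every edge at `w` has colour `d`. Representatives of the other `ω` colours complete the
      -- clique, and all `n - 1` other vertices are available as pendent ones.
      only-dominant : ∀ w → ¬ (∃ λ i → i ≢ d × Sees χ w i) → MonochromaticPA χ (suc t) (suc ω)
      only-dominant w only =
        PA-in-neighbourhood χ
          (Allₚ.map⁺ (All.map (λ {i} i≢d → λ { refl → only (i , i≢d , rep-sees i) }) is≢d)
            ∷ reps! (remaining! (d ∷ [])) is≢d)
          (All.map hub (Allₚ.map⁺ (All.map (λ {i} i≢d → λ { refl → only (i , i≢d , rep-sees i) }) is≢d)))
          (reps-clique (remaining! (d ∷ [])) is≢d)
          (w∉ns ∷ Unique-∖ (w ∷ []) (Uniqueₚ.allFin⁺ n))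
          (All.map hub w∉ns)
          (subst (ω ≤_) (sym (Listₚ.length-map rep (remaining (d ∷ []))))
            (ℕ.s≤s⁻¹ (length-allFin-∖ (d ∷ []))))
          ω≤t
          (ℕ.s≤s⁻¹ (begin
            suc t                                  ≤⟨ s≤s (ℕₚ.m≤n*m t ω {{ℕ.>-nonZero (ℕₚ.≤-trans (s≤s z≤n) 3≤ω)}}) ⟩
            suc (ω * t)                            ≤⟨ large ⟩
            n                                      ≤⟨ length-allFin-∖ (w ∷ []) ⟩
            suc (length (allFin n ∖ (w ∷ [])))     ∎))
        where
        open ℕₚ.≤-Reasoning
        is≢d : All (_≢ d) (remaining (d ∷ []))
        is≢d = All.map ≢-sym (remaining-≢ (d ∷ []) (here refl))

        w∉ns : All (w ≢_) (allFin n ∖ (w ∷ []))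
        w∉ns = All.tabulate λ j∈ → λ { refl → proj₂ (∈-∖⁻ {xs = allFin n} (w ∷ []) j∈) (here refl) }

        hub : ∀ {u} → w ≢ u → colour w u ≡ d
        hub w≢u = decidable-stable (_ Fin.≟ _) λ neq → only (_ , neq , sees-edge w≢u)

      module _ {j : Colour} (j≢d : j ≢ d) {T : List (Fin n)} (t<T : t < length T) (T! : Unique T)
               (T-sees : ∀ {u} → u ∈ T → Sees χ u j) where

        -- The hub represents a third colour `i`, so it is joined to all of `T` in colour `d`. Using
        -- both `u` and `w` from the class of `j` makes up for `d` having no representative: with
        -- the hub and the remaining representatives the clique has at least `suc ω` vertices.
        with-dominant-edge : ∀ {u w} → u ∈ T → w ∈ T → u ≢ w → colour u w ≡ d →
                             MonochromaticPA χ (suc t) (suc ω)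
        with-dominant-edge {u} {w} u∈ w∈ u≢w uw≡d
          with i , i∉ ← fresh (d ∷ j ∷ []) (s≤s (ℕₚ.<⇒≤ 3≤ω)) =
          PA-in-neighbourhood χ
            ((away u∈ ∷ away w∈ ∷ reps-apart (rep-sees i) i≢d is≢d i≢is) ∷
             (u≢w ∷ reps-apart (T-sees u∈) j≢d is≢d j≢is) ∷
             reps-apart (T-sees w∈) j≢d is≢d j≢is ∷
             reps! (remaining! used) is≢d)
            (toward u∈ ∷ toward w∈ ∷ reps-cross (rep-sees i) i≢d is≢d i≢is)
            ((uw≡d ∷ reps-cross (T-sees u∈) j≢d is≢d j≢is) ∷
             reps-cross (T-sees w∈) j≢d is≢d j≢is ∷
             reps-clique (remaining! used) is≢d)
            (All.tabulate away ∷ T!)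
            (All.tabulate toward)
            (subst (λ l → ω ≤ 2 + l) (sym (Listₚ.length-map rep (remaining used)))
              (ℕ.s≤s⁻¹ (length-allFin-∖ used)))
            ω≤t
            (ℕₚ.<⇒≤ t<T)
          where
          used : List Colour
          used = d ∷ j ∷ i ∷ []

          is≢d : All (_≢ d) (remaining used)
          is≢d = All.map ≢-sym (remaining-≢ used (here refl))

          j≢is : All (j ≢_) (remaining used)
          j≢is = remaining-≢ used (there (here refl))

          i≢is : All (i ≢_) (remaining used)
          i≢is = remaining-≢ used (there (there (here refl)))

          i≢d : i ≢ d
          i≢d = i∉ ∘ here

          i≢j : i ≢ j
          i≢j = i∉ ∘ there ∘ here

          away : ∀ {x} → x ∈ T → rep i ≢ x
          away x∈ = apart (rep-sees i) i≢d (T-sees x∈) j≢d i≢j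

          toward : ∀ {x} → x ∈ T → colour (rep i) x ≡ d
          toward x∈ = cross (rep-sees i) i≢d (T-sees x∈) j≢d i≢j

        large-class : MonochromaticPA χ (suc t) (suc ω)
        large-class
          with Any.any? (λ u → Any.any? (λ w → ¬? (u Fin.≟ w) ×-dec (colour u w Fin.≟ d)) T) T
        ... | yes hit =
          let u , u∈ , hit′ = find hit
              w , w∈ , u≢w , uw≡d = find hit′
          in with-dominant-edge u∈ w∈ u≢w uw≡d
        ... | no miss = PA-in-clique χ T! coloured-j ω≤t t<T
          where
          coloured-j : ∀ {u w} → u ∈ T → w ∈ T → u ≢ w → colour u w ≡ j
          coloured-j u∈ w∈ u≢w with two (T-sees u∈) (dom _) j≢d (sees-edge u≢w)
          ... | inj₁ uw≡j = uw≡j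
          ... | inj₂ uw≡d = contradiction (lose u∈ (lose w∈ (u≢w , uw≡d))) miss

      other? : ∀ w → Dec (∃ λ i → i ≢ d × Sees χ w i)
      other? w = Finₚ.any? λ i → ¬? (i Fin.≟ d) ×-dec sees? χ w i

      -- Choosing for each vertex a colour other than `d` sorts more than `ω * t` vertices into at
      -- most `ω` classes, so one class has more than `t`.
      all-other : (∀ w → ∃ λ i → i ≢ d × Sees χ w i) → MonochromaticPA χ (suc t) (suc ω)
      all-other other =
        let j , T , j∈ , t<T , T! , T≡j = pigeonhole t (proj₁ ∘ other) (remaining (d ∷ []))
              (Uniqueₚ.allFin⁺ n) (All.tabulate λ {w} _ → other-remaining w) bound
        in large-class (≢-sym (All.lookup (remaining-≢ (d ∷ []) (here refl)) j∈)) t<T T!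
             λ {u} u∈ → subst (Sees χ u) (All.lookup T≡j u∈) (proj₂ (proj₂ (other u)))
        where
        other-remaining : ∀ w → proj₁ (other w) ∈ remaining (d ∷ [])
        other-remaining w = let i , i≢d , _ = other w in
          ∈-∖⁺ (d ∷ []) (∈-allFin i) λ { (here i≡d) → i≢d i≡d }

        open ℕₚ.≤-Reasoning
        bound : length (remaining (d ∷ [])) * t < length (allFin n)
        bound = begin-strict
          length (remaining (d ∷ [])) * t   ≤⟨ ℕₚ.*-monoˡ-≤ t (ℕ.s≤s⁻¹
            (subst (length (remaining (d ∷ [])) <_) (Listₚ.length-tabulate {n = suc ω} (λ i → i))
              (length-∖-∈ (∈-allFin d)))) ⟩
          ω * t                             <⟨ large ⟩
          n                                 ≡⟨ Listₚ.length-tabulate {n = n} (λ i → i) ⟨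
          length (allFin n)                 ∎

      dominated⇒PA : MonochromaticPA χ (suc t) (suc ω)
      dominated⇒PA with Finₚ.any? (λ w → ¬? (other? w))
      ... | yes (w , only) = only-dominant w only
      ... | no none        = all-other λ w → decidable-stable (other? w) λ ¬other → none (w , ¬other)

  rainbow-or-PA : Target
  rainbow-or-PA with three-seen?
  ... | yes (_ , _ , _ , _ , (vi , vj , vl) , i≢j , i≢l , j≢l) = three-seen vi vj vl i≢j i≢l j≢l
  ... | no ¬three = inj₂ (LocallyTwoColoured.Dominated.dominated⇒PA two
                           (proj₂ (LocallyTwoColoured.dominating two)))
    where
    two : ∀ {v i j l} → Sees χ v i → Sees χ v j → i ≢ j → Sees χ v l → l ≡ i ⊎ l ≡ j
    two {i = i} {j} {l} vi vj i≢j vl with l Fin.≟ i | l Fin.≟ j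
    ... | yes l≡i | _       = inj₁ l≡i
    ... | no _    | yes l≡j = inj₂ l≡j
    ... | no l≢i  | no l≢j  = contradiction
      (_ , _ , _ , _ , (vi , vj , vl) , i≢j , ≢-sym l≢i , ≢-sym l≢j) ¬three

-- Lower bound: the block colouring.

module BlockColouring (a b : ℕ) where
  -- Again one less than in the theorem. The form `2 + _` provides the two blocks and the two
  -- vertices per block that make the colouring exact.
  ω t : ℕ
  ω = 2 + a
  t = 2 + b

  block : Fin (ω * t) → Fin ω
  block = proj₁ ∘ Fin.remQuot {ω} t

  offset : Fin (ω * t) → Fin t
  offset = proj₂ ∘ Fin.remQuot {ω} t

  cell : Fin ω → Fin t → Fin (ω * t)
  cell = Fin.combine

  block-cell : ∀ i j → block (cell i j) ≡ i
  block-cell i j = cong proj₁ (Finₚ.remQuot-combine i j)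

  position-injective : ∀ {u v} → block u ≡ block v → offset u ≡ offset v → u ≡ v
  position-injective {u} {v} eq eq′ = trans (sym (Finₚ.combine-remQuot {ω} t u))
    (trans (cong₂ Fin.combine eq eq′) (Finₚ.combine-remQuot {ω} t v))

  blockColour : Fin (ω * t) → Fin (ω * t) → Fin (suc ω)
  blockColour u v with block u Fin.≟ block v
  ... | yes _ = suc (block u)
  ... | no  _ = zero

  inside : ∀ {u v i} → block u ≡ i → block v ≡ i → blockColour u v ≡ suc i
  inside {u} {v} refl eq with block u Fin.≟ block v
  ... | yes _ = refl
  ... | no neq = contradiction (sym eq) neq

  across : ∀ {u v} → block u ≢ block v → blockColour u v ≡ zero
  across {u} {v} neq with block u Fin.≟ block v
  ... | yes eq = contradiction eq neq
  ... | no _   = refl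

  inside⁻ : ∀ {u v i} → blockColour u v ≡ suc i → block u ≡ i × block v ≡ i
  inside⁻ {u} {v} eq with block u Fin.≟ block v | eq
  ... | yes eq′ | refl = refl , sym eq′

  across⁻ : ∀ {u v} → blockColour u v ≡ zero → block u ≢ block v
  across⁻ eq same with () ← trans (sym eq) (inside refl (sym same))

  blockColouring : EdgeColouring (K (ω * t)) (suc ω)
  blockColouring = record { colour = blockColour ; colourSym = symmetric ; exact = exact }
    where
    symmetric : ∀ u v → blockColour u v ≡ blockColour v u
    symmetric u v with block u Fin.≟ block v in eq
    ... | yes same = sym (inside (sym same) refl)
    ... | no  neq  = sym (across (≢-sym neq))

    exact : ∀ c → ∃ λ u → ∃ λ v → u ≢ v × blockColour u v ≡ c
    exact zero    = cell zero zero , cell (suc zero) zero ,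
      (λ eq → contradiction (Finₚ.combine-injectiveˡ {ω} {t} zero zero (suc zero) zero eq) λ ()) ,
      across λ eq → contradiction (trans (sym (block-cell zero zero))
                                         (trans eq (block-cell (suc zero) zero))) λ ()
    exact (suc i) = cell i zero , cell i (suc zero) ,
      (λ eq → contradiction (Finₚ.combine-injectiveʳ {ω} {t} i zero i (suc zero) eq) λ ()) ,
      inside (block-cell i zero) (block-cell i (suc zero))

  -- Both edges lie inside the block of the shared vertex `v`.
  consecutive : ∀ {u v w} → blockColour u v ≢ zero → blockColour v w ≢ zero →
                blockColour u v ≡ blockColour v w
  consecutive {u} {v} {w} uv vw with block u Fin.≟ block v | block v Fin.≟ block w
  ... | yes p | yes _ = cong suc p
  ... | yes _ | no _  = contradiction refl vw
  ... | no _  | _     = contradiction refl uv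

  -- Two consecutive edges inside blocks have the same colour, so a rainbow P₅ would
  -- have an edge across blocks in its first half and another one in its second half.
  no-rainbow : ∀ (φ : Copy (P 5) (K (ω * t))) → ¬ Rainbow blockColouring φ
  no-rainbow φ rainbow =
    cases (edge (# 0) Fin.≟ zero) (edge (# 1) Fin.≟ zero) (edge (# 2) Fin.≟ zero) (edge (# 3) Fin.≟ zero)
    where
    open Copy φ

    edge : Fin 4 → Fin (suc ω)
    edge i = blockColour (embed (Fin.inject₁ i)) (embed (suc i))

    edge-injective : ∀ {i j} → i ≢ j → edge i ≢ edge j
    edge-injective {i} {j} i≢j eq
      with rainbow {Fin.inject₁ i} {suc i} {Fin.inject₁ j} {suc j}
                   (inj₁ (cong suc (Finₚ.toℕ-inject₁ i))) (inj₁ (cong suc (Finₚ.toℕ-inject₁ j))) eq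
    ... | inj₁ (_ , 1+i≡1+j)     = i≢j (Finₚ.suc-injective 1+i≡1+j)
    -- A reversed match would give both `i = j + 1` and `i + 1 = j`.
    ... | inj₂ (i≡1+j , 1+i≡j)   = ℕₚ.<-irrefl
      (trans (sym (Finₚ.toℕ-inject₁ i)) (cong toℕ i≡1+j))
      (ℕₚ.m≤n⇒m≤1+n (ℕₚ.≤-reflexive (trans (cong toℕ 1+i≡j) (Finₚ.toℕ-inject₁ j))))

    cases : Dec (edge (# 0) ≡ zero) → Dec (edge (# 1) ≡ zero) →
            Dec (edge (# 2) ≡ zero) → Dec (edge (# 3) ≡ zero) → ⊥
    cases (no p)  (no q)  _       _       = edge-injective {# 0} {# 1} (λ ()) (consecutive p q)
    cases _       _       (no p)  (no q)  = edge-injective {# 2} {# 3} (λ ()) (consecutive p q)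
    cases (yes p) _       (yes q) _       = edge-injective {# 0} {# 2} (λ ()) (trans p (sym q))
    cases (yes p) _       _       (yes q) = edge-injective {# 0} {# 3} (λ ()) (trans p (sym q))
    cases _       (yes p) (yes q) _       = edge-injective {# 1} {# 2} (λ ()) (trans p (sym q))
    cases _       (yes p) _       (yes q) = edge-injective {# 1} {# 3} (λ ()) (trans p (sym q))

  -- In colour `zero` the `suc ω` clique vertices would need distinct blocks, but there are only
  -- `ω`. In colour `suc c` every vertex is joined to the hub inside block `c`, which has only `t`
  -- places for `suc t` vertices.
  no-monochromatic : ω ≤ t → ∀ (φ : Copy (PA (suc t) (suc ω)) (K (ω * t))) →
                     ¬ Monochromatic blockColouring φ
  no-monochromatic ω≤t φ (zero , mono) =
    let i , j , i<j , eq = Finₚ.pigeonhole (ℕₚ.n<1+n ω) (block ∘ embed ∘ clique)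
    in across⁻ (mono {clique i} {clique j}
         ( (λ same → ℕₚ.<⇒≢ i<j (trans (sym (Finₚ.toℕ-inject≤ i _))
                                  (trans (cong toℕ same) (Finₚ.toℕ-inject≤ j _))))
         , inj₁ (clique< i , clique< j))) eq
    where
    open Copy φ
    clique : Fin (suc ω) → Fin (suc t)
    clique i = Fin.inject≤ i (s≤s ω≤t)

    clique< : ∀ i → toℕ (clique i) < suc ω
    clique< i = subst (_< suc ω) (sym (Finₚ.toℕ-inject≤ i _)) (Finₚ.toℕ<n i)
  no-monochromatic ω≤t φ (suc c , mono) =
    let i , j , i<j , eq = Finₚ.pigeonhole (ℕₚ.n<1+n t) (offset ∘ embed)
    in ℕₚ.<⇒≢ i<j (cong toℕ (injective
         (position-injective (trans (in-block i) (sym (in-block j))) eq)))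
    where
    open Copy φ

    hub : ∀ v → zero ≢ v → Graph.Adj (PA (suc t) (suc ω)) zero v
    hub v 0≢v with toℕ v ℕ.<? suc ω
    ... | yes v<ω = 0≢v , inj₁ (s≤s z≤n , v<ω)
    ... | no  v≮ω = 0≢v , inj₂ (inj₁ (refl , ℕₚ.≮⇒≥ v≮ω))

    in-block : ∀ v → block (embed v) ≡ c
    in-block zero    = proj₁ (inside⁻ (mono (hub (suc zero) λ ())))
    in-block (suc v) = proj₂ (inside⁻ (mono (hub (suc v) λ ())))

theorem4p1 : (k t ω : ℕ) → k ≡ ω → k ≥ 4 → t ≥ ω + 1 →
    gr[ k ]⟨ P 5 ∶ PA t ω ⟩≡ ((ω ∸ 1) * (t ∸ 1) + 1)
-- From here `ω` and `t` are the predecessors of the given parameters, and `ω` is `2 + a`.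
theorem4p1 (suc ω) (suc t) _ refl (s≤s 3≤ω@(s≤s (s≤s {n = a} _))) (s≤s ω+1≤t) =
  (enough-edges , λ n n≥ χ → rainbow-or-PA χ 3≤ω ω<t (subst (_≤ n) (ℕₚ.+-comm (ω * t) 1) n≥)) ,
  λ M (_ , bound) → minimal M bound
  where
  ω<t : ω < t
  ω<t = subst (_≤ t) (ℕₚ.+-comm ω 1) ω+1≤t

  open ℕₚ.≤-Reasoning

  enough-edges : (ω * t + 1) C 2 ≥ suc ω
  enough-edges = begin
    suc ω                       ≤⟨ ω<t ⟩
    t                           ≤⟨ ℕₚ.m≤n*m t ω ⟩
    ω * t                       ≡⟨ nC1≡n (ω * t) ⟨
    (ω * t) C 1                 ≤⟨ ℕₚ.m≤m+n _ _ ⟩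
    (ω * t) C 1 + (ω * t) C 2   ≡⟨ nCk+nC[k+1]≡[n+1]C[k+1] (ω * t) 1 ⟩
    suc (ω * t) C 2             ≡⟨ cong (_C 2) (ℕₚ.+-comm (ω * t) 1) ⟨
    (ω * t + 1) C 2             ∎

  minimal : ∀ M → (∀ n → n ≥ M → (χ : EdgeColouring (K n) (suc ω)) →
                     RainbowP χ 5 ⊎ MonochromaticPA χ (suc t) (suc ω)) → ω * t + 1 ≤ M
  minimal M bound = subst (_≤ M) (ℕₚ.+-comm 1 (ω * t)) (ℕₚ.≰⇒> below)
    where
    below : ¬ M ≤ ω * t
    -- A bound `M ≤ ω * t` would apply to `n = ω * t`, where the block colouring is a
    -- counterexample.
    below M≤ with s≤s (s≤s {n = b} _) ← ω<t with bound (ω * t) M≤ (BlockColouring.blockColouring a b)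
    ... | inj₁ (φ , rainbow) = BlockColouring.no-rainbow a b φ rainbow
    ... | inj₂ (φ , mono)    = BlockColouring.no-monochromatic a b (ℕₚ.<⇒≤ ω<t) φ mono
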